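{- There is a $5.25$-competitive algorithm for non-preemptive semi-online machine minimization with a uniform deadline (i.e. $d_j=d$ for all jobs $j$).
   Context: Machine minimization with deadlines: each job $j$ of a finite instance has integer release date $r_j$, processing time $p_j$ and deadline $d_j$. A feasible non-preemptive schedule on a given number of identical machines processes each job uninterrupted on a single machine for $p_j$ consecutive time units within $[r_j,d_j]$, each machine processing at most one job at a time. $m$ is the minimum number of machines admitting such a schedule. Semi-online: each job becomes known only at its release date, decisions are made over time, and $m$ is known in advance. An algorithm is $c$-competitive if on every instance it produces a feasible schedule using at most $c\cdot m$ machines. -}

module Defs where

open import Data.Nat using (ℕ; _+_; _*_; _≤_; _<_; _≤?_)
open import Data.Nat.Properties using ()
open import Data.Fin using (Fin)
open import Data.List using (List; []; _∷_; length; filter; lookup; allFin; map)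
open import Data.List.Relation.Unary.All using (All)
open import Data.Product using (Σ; ∃; _×_; _,_; proj₁; proj₂)
open import Data.Sum using (_⊎_)
open import Relation.Binary.PropositionalEquality using (_≡_; _≢_)
open import Relation.Nullary using (¬_)

record Job : Set where
  constructor job
  field
    r : ℕ
    p : ℕ
    d : ℕ
open Job public

-- A finite instance: a list of jobs (jobs are identified by their position).
Instance : Set
Instance = List Job

Schedule : Instance → Set
Schedule I = Fin (length I) → ℕ × ℕ

start : (I : Instance) → Schedule I → Fin (length I) → ℕ
start I σ i = proj₁ (σ i)

machine : (I : Instance) → Schedule I → Fin (length I) → ℕ
machine I σ i = proj₂ (σ i)

FeasibleSchedule : (I : Instance) → ℕ → Schedule I → Set
FeasibleSchedule I k σ =
  (∀ i → machine I σ i < k) ×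
  (∀ i → r (lookup I i) ≤ start I σ i) ×
  (∀ i → start I σ i + p (lookup I i) ≤ d (lookup I i)) ×
  (∀ i j → i ≢ j → machine I σ i ≡ machine I σ j →
     (start I σ i + p (lookup I i) ≤ start I σ j) ⊎
     (start I σ j + p (lookup I j) ≤ start I σ i))

Feasible : Instance → ℕ → Set
Feasible I k = Σ (Schedule I) (FeasibleSchedule I k)

IsOpt : Instance → ℕ → Set
IsOpt I m = Feasible I m × (∀ k → Feasible I k → m ≤ k)

UniformDeadline : Instance → Set
UniformDeadline I = ∃ λ D → All (λ j → d j ≡ D) I

releasedBy : ℕ → Instance → Instance
releasedBy t I = filter (λ j → r j ≤? t) I

decisionsBy : ℕ → (I : Instance) → Schedule I → List (Job × ℕ × ℕ)
decisionsBy t I σ =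
  Data.List.map (λ i → lookup I i , σ i)
    (filter (λ i → start I σ i ≤? t) (allFin (length I)))

-- A semi-online algorithm: given m (known in advance) and the instance it
-- outputs a schedule, subject to non-anticipation: the decisions made up to
-- time t depend only on m and the jobs released up to time t.
Algorithm : Set
Algorithm = (m : ℕ) → (I : Instance) → Schedule I

NonAnticipatory : Algorithm → Set
NonAnticipatory A =
  ∀ m t (I I′ : Instance) → releasedBy t I ≡ releasedBy t I′ →
    decisionsBy t I (A m I) ≡ decisionsBy t I′ (A m I′)

-- c-competitive with c = a / b: on every uniform-deadline instance with
-- optimum m, a feasible schedule on k machines with b·k ≤ a·m.
CompetitiveUniform : ℕ → ℕ → Algorithm → Set
CompetitiveUniform a b A =
  ∀ m (I : Instance) → UniformDeadline I → IsOpt I m →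
    ∃ λ k → b * k ≤ a * m × FeasibleSchedule I k (A m I)

{-# OPTIONS --safe #-}

-- A job is loose if it is at most a third as long as its window [r, d), and
-- tight otherwise.  The two kinds run in separate pools of 3m and ⌊9m/4⌋
-- machines, each by list scheduling in order of release.
--
-- Tight jobs start at their release: each of those running at time t contains,
-- in a schedule on m machines, one of the points t, t + L/3, t + 2L/3 where
-- L = d - t, so there are at most 3m of them.
--
-- For loose jobs put k = ⌊9m/4⌋ and B = 2k - 3m.  By induction on t, the
-- optimum has done at most B (d - t) / 3 more work by time t than the algorithm:
-- * if more than B machines are busy, the algorithm catches up fast enough;
-- * if a started job has more than (d - t) / 3 left, then it waited for over
--   two thirds of the time since its release, with all k machines busy;
-- * otherwise at most B jobs are unfinished, each with at most (d - t) / 3 left.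
-- A loose job missing the deadline keeps all k machines busy for two thirds of
-- its window, which by this inequality exceeds the total work.
module Submission where

open import Defs
open import Data.Bool using (Bool; true; false; if_then_else_)
import Data.Bool as Bool
open import Data.Empty using (⊥; ⊥-elim)
open import Data.Fin using (Fin; zero; suc; toℕ; fromℕ<; combine)
  renaming (_<_ to _<ᶠ_; _≟_ to _≟ᶠ_)
open import Data.Fin.Properties
  using (any?; toℕ<n; toℕ-injective; toℕ-fromℕ<; fromℕ<-injective; combine-injective; pigeonhole)
  renaming (suc-injective to suc-injectiveᶠ; <-cmp to <-cmpᶠ; <⇒≢ to <⇒≢ᶠ)
open import Data.List using (List; []; _∷_; _++_; length; lookup; filter; map; allFin; tabulate)
open import Data.List.Membership.Propositional.Properties using (∈-lookup)
open import Data.List.Properties using (filter-++; filter-accept; filter-reject; map-tabulate; ++-assoc)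
open import Data.List.Relation.Unary.All using (All; []; _∷_)
import Data.List.Relation.Unary.All as All
import Data.List.Relation.Unary.All.Properties as All
open import Data.Nat
  using (ℕ; zero; suc; _+_; _*_; _∸_; _⊓_; _⊔_; _/_; _%_; _≤_; _<_; _≤?_; _<?_; _≟_; z≤n; s≤s; >-nonZero)
open import Data.Nat.DivMod using (m/n*n≤m; m≡m%n+[m/n]*n; m%n<n)
open import Data.Nat.Induction using (<-rec)
open import Data.Nat.Properties hiding (_≟_; _≤?_; _<?_)
open import Algebra.Properties.Semiring.Sum +-*-semiring
  using (sum; ∑-comm; ∑-distrib-+; *-distribˡ-sum)
open import Data.Nat.Tactic.RingSolver using (solve-∀)
open import Data.Product using (Σ; ∃; _×_; _,_; proj₁; proj₂)
open import Data.Sum using (_⊎_; inj₁; inj₂)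
import Data.Sum as Sum
open import Data.Unit using (⊤; tt)
open import Function using (_∘_; id)
open import Relation.Binary using (tri<; tri≈; tri>)
open import Relation.Binary.PropositionalEquality
  using (_≡_; _≢_; refl; sym; trans; cong; cong₂; subst)
open import Relation.Nullary using (¬_; Dec; yes; no; does; contradiction)
open import Relation.Nullary.Decidable using (_×-dec_; dec-true; dec-false)

-- Indicator sums and double counting.

𝟙 : {P : Set} → Dec P → ℕ
𝟙 (yes _) = 1
𝟙 (no _)  = 0

𝟙-yes : {P : Set} (P? : Dec P) → P → 𝟙 P? ≡ 1
𝟙-yes (yes _) _ = refl
𝟙-yes (no ¬p) p = contradiction p ¬p

𝟙-no : {P : Set} (P? : Dec P) → ¬ P → 𝟙 P? ≡ 0
𝟙-no (yes p) ¬p = contradiction p ¬p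
𝟙-no (no _)  _  = refl

𝟙≤ : {P : Set} (P? : Dec P) {c : ℕ} → (P → 1 ≤ c) → 𝟙 P? ≤ c
𝟙≤ (yes p) h = h p
𝟙≤ (no _)  _ = z≤n

sum-mono-≤ : ∀ {n} {f g : Fin n → ℕ} → (∀ i → f i ≤ g i) → sum f ≤ sum g
sum-mono-≤ {zero}  f≤g = z≤n
sum-mono-≤ {suc n} f≤g = +-mono-≤ (f≤g zero) (sum-mono-≤ (f≤g ∘ suc))

term≤sum : ∀ {n} (f : Fin n → ℕ) i → f i ≤ sum f
term≤sum f zero    = m≤m+n _ _
term≤sum f (suc i) = ≤-trans (term≤sum (f ∘ suc) i) (m≤n+m _ _)

sum-ones : ∀ n → sum {n} (λ _ → 1) ≡ n
sum-ones zero    = refl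
sum-ones (suc n) = cong suc (sum-ones n)

sum-zeros : ∀ n → sum {n} (λ _ → 0) ≡ 0
sum-zeros zero    = refl
sum-zeros (suc n) = sum-zeros n

-- The lower bound on `c` is asked only from an index satisfying `P`, so that `c` may itself be an
-- indicator, as in `double-count`.
sum-𝟙≤ : ∀ {n c} {P : Fin n → Set} (P? : ∀ i → Dec (P i)) →
         (∀ i j → P i → P j → i ≡ j) → (∀ i → P i → 1 ≤ c) →
         sum (λ i → 𝟙 (P? i)) ≤ c
sum-𝟙≤ {zero}  P? uniq pos = z≤n
sum-𝟙≤ {suc n} {c} P? uniq pos with P? zero
... | no  _  = sum-𝟙≤ (P? ∘ suc) (λ i j pi pj → suc-injectiveᶠ (uniq _ _ pi pj)) (pos ∘ suc)
... | yes p₀ = subst (λ x → suc x ≤ c) (sym rest) (pos zero p₀)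
  where
  rest : sum (λ i → 𝟙 (P? (suc i))) ≡ 0
  rest = n≤0⇒n≡0 (sum-𝟙≤ (P? ∘ suc) (λ i j pi pj → suc-injectiveᶠ (uniq _ _ pi pj))
           (λ i pi → contradiction (uniq zero (suc i) p₀ pi) λ ()))

-- Count the pairs in `R` in two ways: every `x` with `P x` lies in at least one pair, every `y` in
-- at most one, and only if `Q y` holds.
double-count : ∀ {a b} {P : Fin a → Set} {Q : Fin b → Set} {R : Fin a → Fin b → Set}
  (P? : ∀ x → Dec (P x)) (Q? : ∀ y → Dec (Q y)) (R? : ∀ x y → Dec (R x y)) →
  (∀ x → P x → ∃ λ y → R x y) →
  (∀ x x′ y → R x y → R x′ y → x ≡ x′) →
  (∀ x y → R x y → Q y) →
  sum (λ x → 𝟙 (P? x)) ≤ sum (λ y → 𝟙 (Q? y))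
double-count P? Q? R? total inj image = begin
  sum (λ x → 𝟙 (P? x))
    ≤⟨ sum-mono-≤ (λ x → 𝟙≤ (P? x) λ p → let y , r = total x p in
         ≤-trans (≤-reflexive (sym (𝟙-yes (R? x y) r))) (term≤sum (λ y → 𝟙 (R? x y)) y)) ⟩
  sum (λ x → sum (λ y → 𝟙 (R? x y)))
    ≡⟨ ∑-comm (λ x y → 𝟙 (R? x y)) ⟩
  sum (λ y → sum (λ x → 𝟙 (R? x y)))
    ≤⟨ sum-mono-≤ (λ y → sum-𝟙≤ (λ x → R? x y) (λ x x′ → inj x x′ y)
         (λ x r → ≤-reflexive (sym (𝟙-yes (Q? y) (image x y r))))) ⟩
  sum (λ y → 𝟙 (Q? y)) ∎
  where open ≤-Reasoning

-- Work done over time under given start times.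

Runs : ℕ → ℕ → ℕ → Set
Runs s q t = s ≤ t × t < s + q

runs? : ∀ s q t → Dec (Runs s q t)
runs? s q t = (s ≤? t) ×-dec (t <? s + q)

-- The work received before time `t` by a job of length `q` started at `s`; truncated subtraction
-- makes it 0 before the start.
done : ℕ → ℕ → ℕ → ℕ
done s q t = q ⊓ (t ∸ s)

done-before : ∀ {s q t} → t ≤ s → done s q t ≡ 0
done-before {s} {q} {t} t≤s = trans (cong (q ⊓_) (m≤n⇒m∸n≡0 t≤s)) (⊓-zeroʳ q)

done-during : ∀ {s q t} → t ≤ s + q → done s q t ≡ t ∸ s
done-during {s} {q} {t} t≤s+q =
  m≥n⇒m⊓n≡n (≤-trans (∸-monoˡ-≤ s t≤s+q) (≤-reflexive (m+n∸m≡n s q)))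

done-after : ∀ {s q t} → s + q ≤ t → done s q t ≡ q
done-after {s} {q} {t} s+q≤t =
  m≤n⇒m⊓n≡m (≤-trans (≤-reflexive (sym (m+n∸m≡n s q))) (∸-monoˡ-≤ s s+q≤t))

done-suc : ∀ s q t → done s q (suc t) ≡ done s q t + 𝟙 (runs? s q t)
done-suc s q t with s ≤? t | t <? s + q
... | no s≰t | t<?s+q = trans (done-before (≰⇒> s≰t))
  (cong₂ _+_ (sym (done-before (<⇒≤ (≰⇒> s≰t)))) (sym (𝟙-no (no s≰t ×-dec t<?s+q) (s≰t ∘ proj₁))))
... | yes s≤t | yes t<s+q = trans (done-during t<s+q) (trans (+-∸-assoc 1 s≤t)
  (trans (+-comm 1 _) (cong (_+ 1) (sym (done-during (<⇒≤ t<s+q))))))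
... | yes s≤t | no t≮s+q = trans (done-after (≤-trans (≮⇒≥ t≮s+q) (n≤1+n t)))
  (trans (sym (done-after (≮⇒≥ t≮s+q))) (sym (+-identityʳ _)))

module Volume {n : ℕ} (q s : Fin n → ℕ) where

  running : ℕ → ℕ
  running t = sum (λ i → 𝟙 (runs? (s i) (q i) t))

  volume : ℕ → ℕ
  volume t = sum (λ i → done (s i) (q i) t)

  volume-zero : volume 0 ≡ 0
  volume-zero = n≤0⇒n≡0 (≤-trans
    (sum-mono-≤ (λ i → ≤-reflexive (done-before {s i} {q i} z≤n))) (≤-reflexive (sum-zeros n)))

  volume-suc : ∀ t → volume (suc t) ≡ volume t + running t
  volume-suc t = trans
    (≤-antisym (sum-mono-≤ (λ i → ≤-reflexive (done-suc (s i) (q i) t)))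
               (sum-mono-≤ (λ i → ≤-reflexive (sym (done-suc (s i) (q i) t)))))
    (∑-distrib-+ (λ i → done (s i) (q i) t) (λ i → 𝟙 (runs? (s i) (q i) t)))

  volume-mono : ∀ {t u} → t ≤ u → volume t ≤ volume u
  volume-mono t≤u = sum-mono-≤ (λ i → ⊓-monoʳ-≤ (q i) (∸-monoˡ-≤ (s i) t≤u))

  volume≤total : ∀ t → volume t ≤ sum q
  volume≤total t = sum-mono-≤ (λ i → m⊓n≤m (q i) _)

  volume-upper : ∀ {m} → (∀ t → running t ≤ m) → ∀ t x → volume (t + x) ≤ volume t + m * x
  volume-upper {m} le t zero rewrite +-identityʳ t = m≤m+n _ _
  volume-upper {m} le t (suc x) rewrite +-suc t x = begin
    volume (suc (t + x))          ≡⟨ volume-suc (t + x) ⟩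
    volume (t + x) + running (t + x) ≤⟨ +-mono-≤ (volume-upper le t x) (le (t + x)) ⟩
    volume t + m * x + m          ≡⟨ eq (volume t) m x ⟩
    volume t + m * suc x          ∎
    where
    open ≤-Reasoning
    eq : ∀ v m x → v + m * x + m ≡ v + m * suc x
    eq = solve-∀

  volume-lower : ∀ {k} t x → (∀ u → t ≤ u → u < t + x → k ≤ running u) →
                 volume t + k * x ≤ volume (t + x)
  volume-lower {k} t zero    ge rewrite +-identityʳ t | *-zeroʳ k = ≤-reflexive (+-identityʳ _)
  volume-lower {k} t (suc x) ge rewrite +-suc t x = begin
    volume t + k * suc x             ≡⟨ eq (volume t) k x ⟩
    volume t + k * x + k             ≤⟨ +-mono-≤ (volume-lower t x (λ u lo hi → ge u lo (<-trans hi (n<1+n _))))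
                                                 (ge (t + x) (m≤m+n t x) (n<1+n _)) ⟩
    volume (t + x) + running (t + x) ≡⟨ volume-suc (t + x) ⟨
    volume (suc (t + x))             ∎
    where
    open ≤-Reasoning
    eq : ∀ v k x → v + k * suc x ≡ v + k * x + k
    eq = solve-∀

-- The backlog inequality and the deadlines of loose jobs.

-- Here `s` gives the starts of the algorithm and `o` those of the schedule it is compared with.
-- List scheduling enters only through `r≤s` and `s-busy`: while a released job waits, at least `k`
-- jobs run.
module Loose {n : ℕ} (m k B D : ℕ) (r q s o : Fin n → ℕ)
  (3m+B≡2k : 3 * m + B ≡ 2 * k) (3m≤2B+3 : 3 * m ≤ 2 * B + 3) (B<k : B < k)
  (loose : ∀ i → r i + 3 * q i ≤ D)
  (r≤o : ∀ i → r i ≤ o i) (o+q≤D : ∀ i → o i + q i ≤ D)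
  (o-width : ∀ t → Volume.running q o t ≤ m)
  (r≤s : ∀ i → r i ≤ s i)
  (s-busy : ∀ i t → r i ≤ t → t < s i → k ≤ Volume.running q s t)
  where

  private
    module O = Volume q o
    module S = Volume q s

  -- Scaled by 3 to avoid division. The remaining time is a variable `z` instead of a truncated
  -- difference, so the claim is vacuous after `D`.
  Backlog : ℕ → Set
  Backlog t = ∀ z → t + z ≡ D → 3 * O.volume t ≤ 3 * S.volume t + B * z

  -- In one time unit the left side gains at most `3 * m` and the allowance shrinks by `B`, while
  -- the algorithm contributes at least `3 * (B + 1)`. This balances exactly when
  -- `3 * m ≤ 2 * B + 3`.
  backlog-many-running : ∀ t → B < S.running t → Backlog t → Backlog (suc t)
  backlog-many-running t B<run IH z t+z≡D = begin
    3 * O.volume (suc t)                      ≡⟨ cong (3 *_) (O.volume-suc t) ⟩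
    3 * (O.volume t + O.running t)            ≡⟨ *-distribˡ-+ 3 (O.volume t) (O.running t) ⟩
    3 * O.volume t + 3 * O.running t          ≤⟨ +-mono-≤ (IH (suc z) (trans (+-suc t z) t+z≡D)) (*-monoʳ-≤ 3 (o-width t)) ⟩
    3 * S.volume t + B * suc z + 3 * m        ≡⟨ cong (λ w → 3 * S.volume t + w + 3 * m) (*-suc B z) ⟩
    3 * S.volume t + (B + B * z) + 3 * m      ≤⟨ +-monoʳ-≤ (3 * S.volume t + (B + B * z)) 3m≤2B+3 ⟩
    3 * S.volume t + (B + B * z) + (2 * B + 3) ≡⟨ eq (S.volume t) B z ⟩
    3 * (S.volume t + suc B) + B * z          ≤⟨ +-monoˡ-≤ (B * z) (*-monoʳ-≤ 3 (+-monoʳ-≤ (S.volume t) B<run)) ⟩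
    3 * (S.volume t + S.running t) + B * z    ≡⟨ cong (λ v → 3 * v + B * z) (S.volume-suc t) ⟨
    3 * S.volume (suc t) + B * z              ∎
    where
    open ≤-Reasoning
    eq : ∀ v B z → 3 * v + (B + B * z) + (2 * B + 3) ≡ 3 * (v + suc B) + B * z
    eq = solve-∀

  private
    -- Over a period of length `x` with `k` machines busy for a time `y` of at least two thirds of
    -- it, the gain `3ky ≥ 2kx = (3m + B)x` pays for the work of the optimum and for the shrinking
    -- allowance.
    weigh : ∀ x y z → 2 * x ≤ 3 * y → B * (z + x) + 3 * (m * x) ≤ 3 * (k * y) + B * z
    weigh x y z 2x≤3y = begin
      B * (z + x) + 3 * (m * x) ≡⟨ eq₁ B z x m ⟩
      (3 * m + B) * x + B * z   ≡⟨ cong (λ w → w * x + B * z) 3m+B≡2k ⟩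
      2 * k * x + B * z         ≡⟨ cong (_+ B * z) (eq₂ k x) ⟩
      k * (2 * x) + B * z       ≤⟨ +-monoˡ-≤ (B * z) (*-monoʳ-≤ k 2x≤3y) ⟩
      k * (3 * y) + B * z       ≡⟨ cong (_+ B * z) (eq₃ k y) ⟩
      3 * (k * y) + B * z       ∎
      where
      open ≤-Reasoning
      eq₁ : ∀ B z x m → B * (z + x) + 3 * (m * x) ≡ (3 * m + B) * x + B * z
      eq₁ = solve-∀
      eq₂ : ∀ k x → 2 * k * x ≡ k * (2 * x)
      eq₂ = solve-∀
      eq₃ : ∀ k y → k * (3 * y) ≡ 3 * (k * y)
      eq₃ = solve-∀

  -- `weigh` applied to the period from `t` to `t + x`; after the busy initial stretch of length
  -- `y`, monotonicity of the volume suffices.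
  backlog-busy : ∀ t x y → Backlog t → (∀ u → t ≤ u → u < t + y → k ≤ S.running u) →
                 y ≤ x → 2 * x ≤ 3 * y → Backlog (t + x)
  backlog-busy t x y IH busy y≤x 2x≤3y z t+x+z≡D = begin
    3 * O.volume (t + x)                                ≤⟨ *-monoʳ-≤ 3 (O.volume-upper o-width t x) ⟩
    3 * (O.volume t + m * x)                            ≡⟨ *-distribˡ-+ 3 (O.volume t) (m * x) ⟩
    3 * O.volume t + 3 * (m * x)                        ≤⟨ +-monoˡ-≤ _ (IH (z + x) (trans (eq₁ t x z) t+x+z≡D)) ⟩
    3 * S.volume t + B * (z + x) + 3 * (m * x)          ≡⟨ +-assoc (3 * S.volume t) _ _ ⟩
    3 * S.volume t + (B * (z + x) + 3 * (m * x))        ≤⟨ +-monoʳ-≤ (3 * S.volume t) (weigh x y z 2x≤3y) ⟩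
    3 * S.volume t + (3 * (k * y) + B * z)              ≡⟨ eq₂ (S.volume t) (k * y) (B * z) ⟩
    3 * (S.volume t + k * y) + B * z                    ≤⟨ +-monoˡ-≤ (B * z) (*-monoʳ-≤ 3 (≤-trans
                                                             (S.volume-lower t y busy) (S.volume-mono (+-monoʳ-≤ t y≤x)))) ⟩
    3 * S.volume (t + x) + B * z                        ∎
    where
    open ≤-Reasoning
    eq₁ : ∀ t x z → t + (z + x) ≡ t + x + z
    eq₁ = solve-∀
    eq₂ : ∀ v w b → 3 * v + (3 * w + b) ≡ 3 * (v + w) + b
    eq₂ = solve-∀

  -- At time `suc t` more than a third of the remaining time is still to be processed, with the work
  -- done moved to the other side of the inequality.
  Late : ℕ → Fin n → Set
  Late t i = r i ≤ t × s i ≤ t × 3 * done (s i) (q i) (suc t) + (D ∸ suc t) < 3 * q i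

  late? : ∀ t i → Dec (Late t i)
  late? t i = (r i ≤? t) ×-dec (s i ≤? t) ×-dec (_ <? _)

  -- Lateness and looseness give `3w + z < 3q ≤ x + z`, so less than a third of the time `x` since
  -- release was spent after the start. The wait `y` thus fills two thirds of it, and the backlog at
  -- the release date carries over to `suc t`.
  backlog-late : ∀ t i → Late t i → Backlog (r i) → Backlog (suc t)
  backlog-late t i (r≤t , s≤t , late) IH z t+z≡D =
    subst Backlog (m+[n∸m]≡n r≤t′)
      (backlog-busy (r i) x y IH
        (λ u lo hi → s-busy i u lo (≤-trans hi (≤-reflexive (m+[n∸m]≡n (r≤s i)))))
        y≤x 2x≤3y)
      z t+z≡D
    where
    open ≤-Reasoning
    x y w : ℕ
    x = suc t ∸ r i
    y = s i ∸ r i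
    w = suc t ∸ s i
    r≤t′ : r i ≤ suc t
    r≤t′ = ≤-trans r≤t (n≤1+n t)
    s≤t′ : s i ≤ suc t
    s≤t′ = ≤-trans s≤t (n≤1+n t)
    y≤x : y ≤ x
    y≤x = ∸-monoˡ-≤ (r i) s≤t′
    y+w≡x : y + w ≡ x
    y+w≡x = +-cancelˡ-≡ (r i) _ _ (begin-equality
      r i + (y + w) ≡⟨ +-assoc (r i) y w ⟨
      r i + y + w   ≡⟨ cong (_+ w) (m+[n∸m]≡n (r≤s i)) ⟩
      s i + w       ≡⟨ m+[n∸m]≡n s≤t′ ⟩
      suc t         ≡⟨ m+[n∸m]≡n r≤t′ ⟨
      r i + x       ∎)
    unfinished : suc t ≤ s i + q i
    unfinished = <⇒≤ (≰⇒> λ fin → <-irrefl (refl {x = 3 * q i}) (begin-strict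
      3 * q i ≡⟨ cong (3 *_) (done-after {s i} {q i} fin) ⟨
      3 * done (s i) (q i) (suc t) ≤⟨ m≤m+n _ _ ⟩
      3 * done (s i) (q i) (suc t) + (D ∸ suc t) <⟨ late ⟩
      3 * q i ∎))
    3w≤x : 3 * w ≤ x
    3w≤x = +-cancelʳ-≤ (r i + z) (3 * w) x (begin
      3 * w + (r i + z)                ≡⟨ eq (r i) w z ⟩
      r i + (3 * w + z)                ≡⟨ cong₂ (λ a b → r i + (3 * a + b)) (done-during {s i} {q i} unfinished) (m+n≡o⇒o∸m≡n {suc t} t+z≡D) ⟨
      r i + (3 * done (s i) (q i) (suc t) + (D ∸ suc t)) ≤⟨ +-monoʳ-≤ (r i) (<⇒≤ late) ⟩
      r i + 3 * q i                    ≤⟨ loose i ⟩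
      D                                ≡⟨ t+z≡D ⟨
      suc t + z                        ≡⟨ cong (_+ z) (trans (+-comm x (r i)) (m+[n∸m]≡n r≤t′)) ⟨
      x + r i + z                      ≡⟨ +-assoc x (r i) z ⟩
      x + (r i + z)                    ∎)
      where
      eq : ∀ r w z → 3 * w + (r + z) ≡ r + (3 * w + z)
      eq = solve-∀
      m+n≡o⇒o∸m≡n : ∀ {m n o} → m + n ≡ o → o ∸ m ≡ n
      m+n≡o⇒o∸m≡n {m} {n} refl = m+n∸m≡n m n
    2x≤3y : 2 * x ≤ 3 * y
    2x≤3y = +-cancelʳ-≤ x (2 * x) (3 * y) (begin
      2 * x + x       ≡⟨ eq x ⟩
      3 * x           ≡⟨ cong (3 *_) y+w≡x ⟨
      3 * (y + w)     ≡⟨ *-distribˡ-+ 3 y w ⟩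
      3 * y + 3 * w   ≤⟨ +-monoʳ-≤ (3 * y) 3w≤x ⟩
      3 * y + x       ∎)
      where
      eq : ∀ x → 2 * x + x ≡ 3 * x
      eq = solve-∀

  -- Every job released by `t` has started, as a waiting one would keep `k > B` jobs running.
  -- Unreleased and completed jobs add no backlog; each of the at most `B` running jobs adds at most
  -- `z`, since none is late.
  backlog-few-running : ∀ t → S.running t ≤ B → (∀ i → ¬ Late t i) → Backlog (suc t)
  backlog-few-running t run≤B ¬late z t+z≡D = begin
    3 * O.volume (suc t)                ≡⟨ *-distribˡ-sum 3 (λ i → done (o i) (q i) (suc t)) ⟩
    sum (λ i → 3 * done (o i) (q i) (suc t))
      ≤⟨ sum-mono-≤ job-bound ⟩
    sum (λ i → 3 * done (s i) (q i) (suc t) + z * 𝟙 (runs? (s i) (q i) t))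
      ≡⟨ ∑-distrib-+ (λ i → 3 * done (s i) (q i) (suc t)) _ ⟩
    sum (λ i → 3 * done (s i) (q i) (suc t)) + sum (λ i → z * 𝟙 (runs? (s i) (q i) t))
      ≡⟨ cong₂ _+_ (*-distribˡ-sum 3 (λ i → done (s i) (q i) (suc t))) (*-distribˡ-sum z (λ i → 𝟙 (runs? (s i) (q i) t))) ⟨
    3 * S.volume (suc t) + z * S.running t ≤⟨ +-monoʳ-≤ (3 * S.volume (suc t)) (*-monoʳ-≤ z run≤B) ⟩
    3 * S.volume (suc t) + z * B        ≡⟨ cong (3 * S.volume (suc t) +_) (*-comm z B) ⟩
    3 * S.volume (suc t) + B * z        ∎
    where
    open ≤-Reasoning
    D∸t≡z : D ∸ suc t ≡ z
    D∸t≡z = trans (cong (_∸ suc t) (sym t+z≡D)) (m+n∸m≡n (suc t) z)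
    job-bound : ∀ i → 3 * done (o i) (q i) (suc t) ≤
                      3 * done (s i) (q i) (suc t) + z * 𝟙 (runs? (s i) (q i) t)
    job-bound i with r i ≤? t
    ... | no r≰t = ≤-trans (≤-reflexive (cong (3 *_) (done-before {o i} {q i} (≤-trans (≰⇒> r≰t) (r≤o i))))) z≤n
    ... | yes r≤t with s i ≤? t
    ...   | no s≰t = contradiction (≤-trans (s-busy i t r≤t (≰⇒> s≰t)) run≤B) (<⇒≱ B<k)
    ...   | yes s≤t with t <? s i + q i
    ...     | no t≮ = ≤-trans (*-monoʳ-≤ 3 (≤-trans (m⊓n≤m (q i) _)
                        (≤-reflexive (sym (done-after (≤-trans (≮⇒≥ t≮) (n≤1+n t))))))) (m≤m+n _ _)
    ...     | yes t< = begin
      3 * done (o i) (q i) (suc t)               ≤⟨ *-monoʳ-≤ 3 (m⊓n≤m (q i) _) ⟩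
      3 * q i                                    ≤⟨ ≮⇒≥ (λ l → ¬late i (r≤t , s≤t , l)) ⟩
      3 * done (s i) (q i) (suc t) + (D ∸ suc t) ≡⟨ cong (3 * done (s i) (q i) (suc t) +_) (trans D∸t≡z (sym (*-identityʳ z))) ⟩
      3 * done (s i) (q i) (suc t) + z * 1       ∎

  -- Course-of-values induction, because the late case falls back on the release date of the late
  -- job.
  backlog : ∀ t → Backlog t
  backlog = <-rec Backlog step
    where
    step : ∀ t → (∀ {u} → u < t → Backlog u) → Backlog t
    step zero    IH z _ = ≤-trans (≤-reflexive (cong (3 *_) O.volume-zero)) z≤n
    step (suc t) IH with B <? S.running t
    ... | yes B<run = backlog-many-running t B<run (IH (n<1+n t))
    ... | no  B≮run with any? (late? t)
    ...   | yes (i , late) = backlog-late t i late (IH (s≤s (proj₁ late)))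
    ...   | no  ¬late      = backlog-few-running t (≮⇒≥ B≮run) (λ i l → ¬late (i , l))

  -- If job `i` missed the deadline, `k` jobs would run throughout its wait. By `weigh` with
  -- `z = 0`, all work would be done by time `r i + y`, yet jobs still run in the next time unit.
  meets-deadline : ∀ i → s i + q i ≤ D
  meets-deadline i = ≮⇒≥ λ missed → <-irrefl refl (begin-strict
    3 * sum q                        ≤⟨ *-monoʳ-≤ 3 all-done ⟩
    3 * O.volume D                   ≤⟨ bound-at-D missed ⟩
    3 * S.volume (r i + y)           <⟨ *-monoʳ-< 3 (grows missed) ⟩
    3 * S.volume (r i + suc y)       ≤⟨ *-monoʳ-≤ 3 (S.volume≤total (r i + suc y)) ⟩
    3 * sum q                        ∎)
    where
    open ≤-Reasoning
    x y : ℕ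
    x = D ∸ r i
    -- The longest wait that still meets the deadline: `r i + y` is the latest timely start.
    y = D ∸ q i ∸ r i
    r+q≤D : r i + q i ≤ D
    r+q≤D = ≤-trans (+-monoˡ-≤ (q i) (r≤o i)) (o+q≤D i)
    r+x≡D : r i + x ≡ D
    r+x≡D = m+[n∸m]≡n (m+n≤o⇒m≤o (r i) r+q≤D)
    r+y+q≡D : r i + y + q i ≡ D
    r+y+q≡D = trans (cong (_+ q i) (m+[n∸m]≡n (m+n≤o⇒m≤o∸n (r i) r+q≤D)))
                    (m∸n+n≡m (m+n≤o⇒n≤o (r i) r+q≤D))
    y+q≡x : y + q i ≡ x
    y+q≡x = +-cancelˡ-≡ (r i) _ _ (trans (sym (+-assoc (r i) y (q i))) (trans r+y+q≡D (sym r+x≡D)))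
    2x≤3y : 2 * x ≤ 3 * y
    2x≤3y = +-cancelʳ-≤ x (2 * x) (3 * y) (begin
      2 * x + x       ≡⟨ eq x ⟩
      3 * x           ≡⟨ cong (3 *_) y+q≡x ⟨
      3 * (y + q i)   ≡⟨ *-distribˡ-+ 3 y (q i) ⟩
      3 * y + 3 * q i ≤⟨ +-monoʳ-≤ (3 * y) (+-cancelˡ-≤ (r i) _ _ (≤-trans (loose i) (≤-reflexive (sym r+x≡D)))) ⟩
      3 * y + x       ∎)
      where
      eq : ∀ x → 2 * x + x ≡ 3 * x
      eq = solve-∀
    all-done : sum q ≤ O.volume D
    all-done = sum-mono-≤ (λ j → ≤-reflexive (sym (done-after (o+q≤D j))))
    start-late : D < s i + q i → r i + y < s i
    start-late missed = +-cancelʳ-< (q i) _ _ (≤-trans (s≤s (≤-reflexive r+y+q≡D)) missed)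
    busy : D < s i + q i → ∀ u → r i ≤ u → u < r i + suc y → k ≤ S.running u
    busy missed u lo hi = s-busy i u lo (≤-trans hi (≤-trans (≤-reflexive (+-suc (r i) y)) (start-late missed)))
    grows : D < s i + q i → S.volume (r i + y) < S.volume (r i + suc y)
    grows missed = begin-strict
      S.volume (r i + y)                          <⟨ m<m+n _ (≤-trans (≤-trans (s≤s z≤n) B<k)
        (busy missed (r i + y) (m≤m+n _ _) (≤-reflexive (sym (+-suc (r i) y))))) ⟩
      S.volume (r i + y) + S.running (r i + y)    ≡⟨ S.volume-suc (r i + y) ⟨
      S.volume (suc (r i + y))                    ≡⟨ cong S.volume (+-suc (r i) y) ⟨
      S.volume (r i + suc y)                      ∎
    bound-at-D : D < s i + q i → 3 * O.volume D ≤ 3 * S.volume (r i + y)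
    bound-at-D missed = begin
      3 * O.volume D                               ≡⟨ cong (λ u → 3 * O.volume u) r+x≡D ⟨
      3 * O.volume (r i + x)                       ≤⟨ *-monoʳ-≤ 3 (O.volume-upper o-width (r i) x) ⟩
      3 * (O.volume (r i) + m * x)                 ≡⟨ *-distribˡ-+ 3 (O.volume (r i)) (m * x) ⟩
      3 * O.volume (r i) + 3 * (m * x)             ≤⟨ +-monoˡ-≤ _ (backlog (r i) x r+x≡D) ⟩
      3 * S.volume (r i) + B * x + 3 * (m * x)     ≡⟨ +-assoc (3 * S.volume (r i)) _ _ ⟩
      3 * S.volume (r i) + (B * x + 3 * (m * x))   ≤⟨ +-monoʳ-≤ (3 * S.volume (r i)) (weigh x y 0 2x≤3y) ⟩
      3 * S.volume (r i) + (3 * (k * y) + B * 0)   ≡⟨ eq (S.volume (r i)) (k * y) B ⟩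
      3 * (S.volume (r i) + k * y)                 ≤⟨ *-monoʳ-≤ 3 (S.volume-lower (r i) y
        (λ u lo hi → busy missed u lo (≤-trans hi (+-monoʳ-≤ (r i) (n≤1+n y))))) ⟩
      3 * S.volume (r i + y)                       ∎
      where
      eq : ∀ v w B → 3 * v + (3 * w + B * 0) ≡ 3 * (v + w)
      eq = solve-∀

-- List scheduling on `K` machines.

earliest : (ℕ → ℕ) → ℕ → ℕ
-- This default is also the first candidate, compared with itself at `K = 1`.
earliest f zero = 0
earliest f (suc K) with f (earliest f K) ≤? f K
... | yes _ = earliest f K
... | no  _ = K

earliest≤ : ∀ f K → earliest f (suc K) ≤ K
earliest≤ f zero with f 0 ≤? f 0
... | yes _ = z≤n
... | no  _ = z≤n
earliest≤ f (suc K) with f (earliest f (suc K)) ≤? f (suc K)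
... | yes _ = m≤n⇒m≤1+n (earliest≤ f K)
... | no  _ = ≤-refl

earliest< : ∀ f {K} → 0 < K → earliest f K < K
earliest< f {suc K} _ = s≤s (earliest≤ f K)

earliest-min : ∀ (f : ℕ → ℕ) {K μ} → μ < K → f (earliest f K) ≤ f μ
earliest-min f {suc K} {μ} (s≤s μ≤K) with f (earliest f K) ≤? f K | m≤n⇒m<n∨m≡n μ≤K
... | yes _ | inj₁ μ<K  = earliest-min f μ<K
... | yes l | inj₂ refl = l
... | no ¬l | inj₁ μ<K  = ≤-trans (<⇒≤ (≰⇒> ¬l)) (earliest-min f μ<K)
... | no _  | inj₂ refl = ≤-refl

-- Histories list the most recently assigned job first.
free : ℕ → List Job → ℕ → ℕ
free K []      ν = 0
free K (j ∷ h) ν =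
  if does (ν ≟ earliest (free K h) K)
  then r j ⊔ free K h (earliest (free K h) K) + p j
  else free K h ν

target : ℕ → List Job → ℕ
target K h = earliest (free K h) K

startAt : ℕ → List Job → Job → ℕ
startAt K h j = r j ⊔ free K h (target K h)

free-target : ∀ K h j → free K (j ∷ h) (target K h) ≡ startAt K h j + p j
free-target K h j rewrite dec-true (target K h ≟ target K h) refl = refl

free-other : ∀ K h j {ν} → ν ≢ target K h → free K (j ∷ h) ν ≡ free K h ν
free-other K h j {ν} ν≢ rewrite dec-false (ν ≟ target K h) ν≢ = refl

free-mono : ∀ K h j ν → free K h ν ≤ free K (j ∷ h) ν
free-mono K h j ν with ν ≟ target K h
... | no  ν≢   = ≤-reflexive (sym (free-other K h j ν≢))
... | yes refl = ≤-trans (m≤n⇒m≤o⊔n (r j) ≤-refl)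
  (≤-trans (m≤m+n _ (p j)) (≤-reflexive (sym (free-target K h j))))

free-++ : ∀ K pre h ν → free K h ν ≤ free K (pre ++ h) ν
free-++ K []        h ν = ≤-refl
free-++ K (j ∷ pre) h ν = ≤-trans (free-++ K pre h ν) (free-mono K (pre ++ h) j ν)

-- If a job released by `t` starts after `t`, the cause is the earlier load of its machine and not
-- its release date, so the machine has no idle gap at `t`.
free-∷ : ∀ K h j {t ν} → r j ≤ t → t < free K (j ∷ h) ν →
  t < free K h ν ⊎ (ν ≡ target K h × Runs (startAt K h j) (p j) t)
free-∷ K h j {t} {ν} r≤t t<free with ν ≟ target K h
... | no  ν≢   = inj₁ (subst (t <_) (free-other K h j ν≢) t<free)
... | yes refl with startAt K h j ≤? t
...   | yes s≤t = inj₂ (refl , s≤t , subst (t <_) (free-target K h j) t<free)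
...   | no  s≰t = inj₁ (≰⇒> λ free≤t → s≰t (⊔-lub r≤t free≤t))

-- The two pools, the histories and the algorithm.

isLoose : Job → Bool
isLoose j = does (3 * p j ≤? d j ∸ r j)

inPool : Bool → List Job → List Job
inPool b = filter (λ j → isLoose j Bool.≟ b)

-- The product is written `m * 3` to match `combine`, which encodes pairs of a machine and a third
-- point.
width : ℕ → Bool → ℕ
width m false = m * 3
width m true  = 9 * m / 4

offset : ℕ → Bool → ℕ
offset m false = 0
offset m true  = m * 3

decide : ℕ → List Job → Job → ℕ × ℕ
decide m h j = startAt (width m b) (inPool b h) j , offset m b + target (width m b) (inPool b h)
  where
  b : Bool
  b = isLoose j

releasedAt : ℕ → List Job → List Job
releasedAt t = filter (λ j → r j ≟ t)

releasedBefore : List Job → ℕ → List Job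
releasedBefore I zero    = []
releasedBefore I (suc t) = releasedAt t I ++ releasedBefore I t

-- Jobs with equal release dates are assigned from the end of the instance to
-- its front, so that histories can be computed by recursion on suffixes.
history : (I L : List Job) → Fin (length L) → List Job
history I (j ∷ L) zero    = releasedAt (r j) L ++ releasedBefore I (r j)
history I (j ∷ L) (suc i) = history I L i

algorithm : Algorithm
algorithm m I i = decide m (history I I i) (lookup I i)

-- Non-anticipation.

-- The suffix `L` is separated from the instance `I`, so that induction can run over `L` while
-- earlier release dates are still read off `I`.
decisions : ℕ → (I L : List Job) → List (Job × ℕ × ℕ)
decisions m I []      = []
decisions m I (j ∷ L) =
  (j , decide m (releasedAt (r j) L ++ releasedBefore I (r j)) j) ∷ decisions m I L

decisions-tabulate : ∀ m I L →
  tabulate (λ i → lookup L i , decide m (history I L i) (lookup L i)) ≡ decisions m I L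
decisions-tabulate m I []      = refl
decisions-tabulate m I (j ∷ L) = cong ((j , decide m (releasedAt (r j) L ++ releasedBefore I (r j)) j) ∷_) (decisions-tabulate m I L)

startsBy? : ∀ t (x : Job × ℕ × ℕ) → Dec (proj₁ (proj₂ x) ≤ t)
startsBy? t x = proj₁ (proj₂ x) ≤? t

filter-map-comm : ∀ {A B : Set} {P : B → Set} (P? : ∀ y → Dec (P y)) (f : A → B) xs →
  map f (filter (λ x → P? (f x)) xs) ≡ filter P? (map f xs)
filter-map-comm P? f []       = refl
filter-map-comm P? f (x ∷ xs) with P? (f x)
... | yes _ = cong (f x ∷_) (filter-map-comm P? f xs)
... | no  _ = filter-map-comm P? f xs

decisionsBy-algorithm : ∀ m t I →
  decisionsBy t I (algorithm m I) ≡ filter (startsBy? t) (decisions m I I)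
decisionsBy-algorithm m t I =
  trans (filter-map-comm (startsBy? t) f (allFin (length I)))
        (cong (filter (startsBy? t)) (trans (map-tabulate id f) (decisions-tabulate m I I)))
  where
  f : Fin (length I) → Job × ℕ × ℕ
  f i = lookup I i , algorithm m I i

bool-cases : ∀ b → b ≡ true ⊎ b ≡ false
bool-cases true  = inj₁ refl
bool-cases false = inj₂ refl

filter-filter : ∀ {A : Set} {P Q : A → Set} (P? : ∀ x → Dec (P x)) (Q? : ∀ x → Dec (Q x)) →
  (∀ {x} → P x → Q x) → ∀ xs → filter P? (filter Q? xs) ≡ filter P? xs
filter-filter P? Q? P⊆Q [] = refl
filter-filter P? Q? P⊆Q (x ∷ xs) with Q? x
... | no ¬q = trans (filter-filter P? Q? P⊆Q xs) (sym (filter-reject P? (¬q ∘ P⊆Q)))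
... | yes _ with P? x
...   | yes _ = cong (x ∷_) (filter-filter P? Q? P⊆Q xs)
...   | no  _ = filter-filter P? Q? P⊆Q xs

releasedAt-releasedBy : ∀ {s t} → s ≤ t → ∀ L → releasedAt s (releasedBy t L) ≡ releasedAt s L
releasedAt-releasedBy {s} {t} s≤t =
  filter-filter (λ j → r j ≟ s) (λ j → r j ≤? t) (λ { refl → s≤t })

releasedBefore-releasedBy : ∀ {s t} → s ≤ t → ∀ I → releasedBefore (releasedBy t I) s ≡ releasedBefore I s
releasedBefore-releasedBy {zero}  s≤t I = refl
releasedBefore-releasedBy {suc s} s<t I =
  cong₂ _++_ (releasedAt-releasedBy (<⇒≤ s<t) I) (releasedBefore-releasedBy (<⇒≤ s<t) I)

filter-∷-cong : ∀ {A : Set} {P : A → Set} (P? : ∀ x → Dec (P x)) x {xs ys} →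
  filter P? xs ≡ filter P? ys → filter P? (x ∷ xs) ≡ filter P? (x ∷ ys)
filter-∷-cong P? x eq with P? x
... | yes _ = cong (x ∷_) eq
... | no  _ = eq

-- A job released after `t` also starts after `t` and is filtered out. The history of a job released
-- by `t` contains only jobs released no later than it, and these survive the restriction.
decisions-releasedBy : ∀ m t I L →
  filter (startsBy? t) (decisions m I L) ≡
  filter (startsBy? t) (decisions m (releasedBy t I) (releasedBy t L))
decisions-releasedBy m t I [] = refl
decisions-releasedBy m t I (j ∷ L) with r j ≤? t
... | no r≰t rewrite filter-reject (λ j′ → r j′ ≤? t) {j} {L} r≰t = trans
  (filter-reject (startsBy? t) (λ s≤t → r≰t (≤-trans (m≤m⊔n (r j) _) s≤t)))
  (decisions-releasedBy m t I L)
... | yes r≤t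
  rewrite filter-accept (λ j′ → r j′ ≤? t) {j} {L} r≤t | releasedAt-releasedBy r≤t L | releasedBefore-releasedBy r≤t I
  = filter-∷-cong (startsBy? t)
      (j , decide m (releasedAt (r j) L ++ releasedBefore I (r j)) j)
      {decisions m I L} {decisions m (releasedBy t I) (releasedBy t L)}
      (decisions-releasedBy m t I L)

nonAnticipatory : NonAnticipatory algorithm
nonAnticipatory m t I I′ eq = trans (decisionsBy-releasedBy I)
  (trans (cong (λ L → filter (startsBy? t) (decisions m L L)) eq) (sym (decisionsBy-releasedBy I′)))
  where
  decisionsBy-releasedBy : ∀ I → decisionsBy t I (algorithm m I) ≡
    filter (startsBy? t) (decisions m (releasedBy t I) (releasedBy t I))
  decisionsBy-releasedBy I = trans (decisionsBy-algorithm m t I) (decisions-releasedBy m t I I)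

-- Consistency of the histories of different jobs.

Extends : List Job → List Job → Set
Extends h h′ = ∃ λ pre → h ≡ pre ++ h′

Extends-++ : ∀ pre {h h′} → Extends h h′ → Extends (pre ++ h) h′
Extends-++ pre (pre′ , refl) = pre ++ pre′ , sym (++-assoc pre pre′ _)

releasedAt-extends : ∀ I L i {t} → r (lookup L i) ≡ t →
  Extends (releasedAt t L ++ releasedBefore I t) (lookup L i ∷ history I L i)
releasedAt-extends I (j ∷ L) zero    refl
  rewrite filter-accept (λ j′ → r j′ ≟ r j) {j} {L} refl = [] , refl
releasedAt-extends I (j ∷ L) (suc i) {t} eq with r j ≟ t
... | yes r≡t rewrite filter-accept (λ j′ → r j′ ≟ t) {j} {L} r≡t =
  Extends-++ (j ∷ []) (releasedAt-extends I L i eq)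
... | no  r≢t rewrite filter-reject (λ j′ → r j′ ≟ t) {j} {L} r≢t = releasedAt-extends I L i eq

releasedBefore-extends : ∀ I i {t} → r (lookup I i) < t →
  Extends (releasedBefore I t) (lookup I i ∷ history I I i)
releasedBefore-extends I i {suc t} (s≤s r≤t) with m≤n⇒m<n∨m≡n r≤t
... | inj₁ r<t = Extends-++ (releasedAt t I) (releasedBefore-extends I i r<t)
... | inj₂ r≡t = releasedAt-extends I I i r≡t

history-extends-released : ∀ I L i {h} → Extends (releasedBefore I (r (lookup L i))) h →
  Extends (history I L i) h
history-extends-released I (j ∷ L) zero    e = Extends-++ (releasedAt (r j) L) e
history-extends-released I (j ∷ L) (suc i) e = history-extends-released I L i e

history-extends-index : ∀ I L i j → i <ᶠ j → r (lookup L i) ≡ r (lookup L j) →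
  Extends (history I L i) (lookup L j ∷ history I L j)
history-extends-index I (x ∷ L) zero    (suc j) _         eq = releasedAt-extends I L j (sym eq)
history-extends-index I (x ∷ L) (suc i) (suc j) (s≤s i<j) eq = history-extends-index I L i j i<j eq

-- Jobs are ordered linearly by release date, then by decreasing index, so of two jobs one is
-- already assigned when the other is decided. This ties the separately computed decisions together.
history-total : ∀ I i j → i ≢ j →
  Extends (history I I j) (lookup I i ∷ history I I i) ⊎
  Extends (history I I i) (lookup I j ∷ history I I j)
history-total I i j i≢j with <-cmp (r (lookup I i)) (r (lookup I j))
... | tri< lt _ _ = inj₁ (history-extends-released I I j (releasedBefore-extends I i lt))
... | tri> _ _ gt = inj₂ (history-extends-released I I i (releasedBefore-extends I j gt))
... | tri≈ _ eq _ with <-cmpᶠ i j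
...   | tri< i<j _ _ = inj₂ (history-extends-index I I i j i<j eq)
...   | tri≈ _ i≡j _ = contradiction i≡j i≢j
...   | tri> _ _ j<i = inj₁ (history-extends-index I I j i j<i (sym eq))

-- Each entry carries an index whose own history is the rest of the list, so the start computed for
-- the entry is the one the algorithm really gives to that index.
Traced : Instance → List Job → Set
Traced I []      = ⊤
Traced I (j ∷ h) = (∃ λ i → lookup I i ≡ j × history I I i ≡ h) × Traced I h

Traced-suffix : ∀ {I} pre {h} → Traced I (pre ++ h) → Traced I h
Traced-suffix []        tr       = tr
Traced-suffix (_ ∷ pre) (_ , tr) = Traced-suffix pre tr

-- `embed` locates the suffix `L` inside `I`.
traced-releasedAt : ∀ I L {t} (embed : Fin (length L) → Fin (length I)) →
  (∀ i → lookup I (embed i) ≡ lookup L i) → (∀ i → history I I (embed i) ≡ history I L i) →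
  Traced I (releasedBefore I t) → Traced I (releasedAt t L ++ releasedBefore I t)
traced-releasedAt I []      embed jobs hists tr = tr
traced-releasedAt I (j ∷ L) {t} embed jobs hists tr with r j ≟ t
... | yes refl rewrite filter-accept (λ j′ → r j′ ≟ r j) {j} {L} refl =
  (embed zero , jobs zero , hists zero) ,
  traced-releasedAt I L (embed ∘ suc) (jobs ∘ suc) (hists ∘ suc) tr
... | no  r≢t rewrite filter-reject (λ j′ → r j′ ≟ t) {j} {L} r≢t =
  traced-releasedAt I L (embed ∘ suc) (jobs ∘ suc) (hists ∘ suc) tr

traced-releasedBefore : ∀ I t → Traced I (releasedBefore I t)
traced-releasedBefore I zero    = tt
traced-releasedBefore I (suc t) =
  traced-releasedAt I I id (λ _ → refl) (λ _ → refl) (traced-releasedBefore I t)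

traced-history : ∀ I i → Traced I (history I I i)
traced-history I i with pre , eq ← releasedBefore-extends I i {suc (r (lookup I i))} ≤-refl =
  proj₂ (Traced-suffix pre (subst (Traced I) eq (traced-releasedBefore I _)))

releasedBefore-< : ∀ I t → All (λ j → r j < t) (releasedBefore I t)
releasedBefore-< I zero    = []
releasedBefore-< I (suc t) = All.++⁺
  (All.map (λ r≡t → s≤s (≤-reflexive r≡t)) (All.all-filter (λ j → r j ≟ t) I))
  (All.map m≤n⇒m≤1+n (releasedBefore-< I t))

history-≤ : ∀ I i → All (λ j → r j ≤ r (lookup I i)) (history I I i)
history-≤ I i with pre , eq ← releasedBefore-extends I i {suc (r (lookup I i))} ≤-refl =
  All.map ≤-pred (All.tail (All.++⁻ʳ pre (subst (All _) eq (releasedBefore-< I _))))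

-- The schedule of the algorithm: busy machines and disjointness.

module Run (m : ℕ) (I : Instance) where

  S : Fin (length I) → ℕ
  S = start I (algorithm m I)

  M : Fin (length I) → ℕ
  M = machine I (algorithm m I)

  J : Fin (length I) → Job
  J = lookup I

  RunsIn : Bool → ℕ → ℕ → Set
  RunsIn b t μ = ∃ λ i → isLoose (J i) ≡ b × Runs (S i) (p (J i)) t × M i ≡ offset m b + μ

  traced-runs : ∀ {j h t μ} (let b = isLoose j) → (∃ λ i → J i ≡ j × history I I i ≡ h) →
    μ ≡ target (width m b) (inPool b h) →
    Runs (startAt (width m b) (inPool b h) j) (p j) t → RunsIn b t μ
  traced-runs (i , refl , refl) refl running = i , refl , running , refl

  -- `free-∷` unrolled along the history: all its jobs are released by `t`, so a machine taken
  -- beyond `t` has no idle gap there.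
  busy-until-free : ∀ b h → Traced I h → ∀ t μ → All (λ j → r j ≤ t) h →
    t < free (width m b) (inPool b h) μ → RunsIn b t μ
  busy-until-free b [] tr t μ _ ()
  busy-until-free b (j ∷ h) (origin , tr) t μ (r≤t ∷ rs≤t) t<free
    with isLoose j Bool.≟ b
  ... | no  _ = busy-until-free b h tr t μ rs≤t t<free
  ... | yes refl with free-∷ (width m b) (inPool b h) j r≤t t<free
  ...   | inj₁ t<free′                = busy-until-free b h tr t μ rs≤t t<free′
  ...   | inj₂ (μ≡ , running) = traced-runs origin μ≡ running

  -- A job goes to the machine of its pool that frees first, so if it starts after `t`, every
  -- machine of the pool is taken beyond `t`.
  busy-while-waiting : ∀ i t → r (J i) ≤ t → t < S i →
    ∀ μ → μ < width m (isLoose (J i)) → RunsIn (isLoose (J i)) t μ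
  busy-while-waiting i t r≤t t<S μ μ<K =
    busy-until-free b (history I I i) (traced-history I i) t μ
      (All.map (λ r≤r → ≤-trans r≤r r≤t) (history-≤ I i))
      (≤-trans (≰⇒> λ free≤t → <⇒≱ t<S (⊔-lub r≤t free≤t))
               (earliest-min (free (width m b) (inPool b (history I I i))) {width m b} {μ} μ<K))
    where
    b : Bool
    b = isLoose (J i)

  -- Assigning job `i` sets the free time of its machine to its end. Free times only grow, and job
  -- `j` starts no earlier than the current one.
  disjoint-ordered : ∀ i j → Extends (history I I j) (J i ∷ history I I i) →
    isLoose (J i) ≡ isLoose (J j) → M i ≡ M j → S i + p (J i) ≤ S j
  disjoint-ordered i j (pre , eq) pool≡ M≡ = begin
    S i + p (J i)
      ≡⟨ free-target K hᵢ (J i) ⟨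
    free K (J i ∷ hᵢ) (target K hᵢ)
      ≤⟨ free-++ K (inPool b pre) (J i ∷ hᵢ) (target K hᵢ) ⟩
    free K (inPool b pre ++ J i ∷ hᵢ) (target K hᵢ)
      ≡⟨ cong₂ (free K) hⱼ≡ target≡ ⟨
    free K hⱼ (target K hⱼ)
      ≤⟨ m≤n⊔m (r (J j)) _ ⟩
    startAt K hⱼ (J j)
      ≡⟨ cong (λ c → startAt (width m c) (inPool c (history I I j)) (J j)) pool≡ ⟩
    S j ∎
    where
    open ≤-Reasoning
    b : Bool
    b = isLoose (J i)
    K : ℕ
    K = width m b
    hᵢ hⱼ : List Job
    hᵢ = inPool b (history I I i)
    hⱼ = inPool b (history I I j)
    hⱼ≡ : hⱼ ≡ inPool b pre ++ J i ∷ hᵢ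
    hⱼ≡ = trans (cong (inPool b) eq) (trans (filter-++ (λ x → isLoose x Bool.≟ b) pre _)
      (cong (inPool b pre ++_) (filter-accept (λ x → isLoose x Bool.≟ b) refl)))
    target≡ : target K hⱼ ≡ target K hᵢ
    target≡ = sym (+-cancelˡ-≡ (offset m b) _ _ (trans M≡
      (cong (λ c → offset m c + target (width m c) (inPool c (history I I j))) (sym pool≡))))

  disjoint : ∀ i j → i ≢ j → isLoose (J i) ≡ isLoose (J j) → M i ≡ M j →
    (S i + p (J i) ≤ S j) ⊎ (S j + p (J j) ≤ S i)
  disjoint i j i≢j pool≡ M≡ = Sum.map
    (λ e → disjoint-ordered i j e pool≡ M≡)
    (λ e → disjoint-ordered j i e (sym pool≡) (sym M≡))
    (history-total I i j i≢j)

-- Tight jobs against a schedule on `m` machines.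

-- The points t, t + L/3, t + 2L/3, with time scaled by 3 to stay in ℕ.
third-point : ∀ {t o q L} → o + q ≤ t + L → t < o + q → L < 3 * q →
  ∃ λ (c : Fin 3) → 3 * o ≤ 3 * t + toℕ c * L × 3 * t + toℕ c * L < 3 * (o + q)
third-point {t} {o} {q} {L} o+q≤D t<o+q L<3q with o ≤? t
... | yes o≤t = zero , ≤-trans (*-monoʳ-≤ 3 o≤t) (m≤m+n (3 * t) 0) ,
  ≤-trans (s≤s (≤-reflexive (+-identityʳ (3 * t)))) (*-monoʳ-< 3 t<o+q)
... | no o≰t with 3 * o ≤? 3 * t + 1 * L
...   | yes early = suc zero , early , (begin-strict
  3 * t + 1 * L <⟨ +-mono-< (*-monoʳ-< 3 (≰⇒> o≰t)) (subst (_< 3 * q) (sym (*-identityˡ L)) L<3q) ⟩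
  3 * o + 3 * q ≡⟨ *-distribˡ-+ 3 o q ⟨
  3 * (o + q)   ∎)
  where open ≤-Reasoning
-- Being longer than `L / 3` and ending by `t + L`, the job starts before the last point; as it
-- starts after the middle point, it runs past the last one.
...   | no late = suc (suc zero) ,
  +-cancelʳ-≤ L (3 * o) (3 * t + 2 * L) (begin
    3 * o + L         ≤⟨ +-monoʳ-≤ (3 * o) (<⇒≤ L<3q) ⟩
    3 * o + 3 * q     ≡⟨ *-distribˡ-+ 3 o q ⟨
    3 * (o + q)       ≤⟨ *-monoʳ-≤ 3 o+q≤D ⟩
    3 * (t + L)       ≡⟨ eq₁ t L ⟩
    3 * t + 2 * L + L ∎) ,
  (begin-strict
    3 * t + 2 * L     ≡⟨ eq₂ t L ⟩
    3 * t + 1 * L + L <⟨ +-mono-< (≰⇒> late) L<3q ⟩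
    3 * o + 3 * q     ≡⟨ *-distribˡ-+ 3 o q ⟨
    3 * (o + q)       ∎)
  where
  open ≤-Reasoning
  eq₁ : ∀ t L → 3 * (t + L) ≡ 3 * t + 2 * L + L
  eq₁ = solve-∀
  eq₂ : ∀ t L → 3 * t + 2 * L ≡ 3 * t + 1 * L + L
  eq₂ = solve-∀

module Competitive (m : ℕ) (I : Instance) (D : ℕ) (deadline : ∀ i → d (lookup I i) ≡ D)
  (σ : Schedule I) (feasible : FeasibleSchedule I m σ) where

  open Run m I

  n : ℕ
  n = length I

  R P O N : Fin n → ℕ
  R i = r (J i)
  P i = p (J i)
  O   = start I σ
  N   = machine I σ

  N<m : ∀ i → N i < m
  N<m = proj₁ feasible

  R≤O : ∀ i → R i ≤ O i
  R≤O = proj₁ (proj₂ feasible)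

  O+P≤D : ∀ i → O i + P i ≤ D
  O+P≤D i = ≤-trans (proj₁ (proj₂ (proj₂ feasible)) i) (≤-reflexive (deadline i))

  R≤S : ∀ i → R i ≤ S i
  R≤S i = m≤m⊔n (R i) _

  exclusive : ∀ {u} i j → N i ≡ N j →
    3 * O i ≤ u → u < 3 * (O i + P i) → 3 * O j ≤ u → u < 3 * (O j + P j) → i ≡ j
  exclusive {u} i j N≡ lo₁ hi₁ lo₂ hi₂ with i ≟ᶠ j
  ... | yes i≡j = i≡j
  ... | no  i≢j with proj₂ (proj₂ (proj₂ feasible)) i j i≢j N≡
  ...   | inj₁ before = contradiction (≤-trans (*-monoʳ-≤ 3 before) lo₂) (<⇒≱ hi₁)
  ...   | inj₂ before = contradiction (≤-trans (*-monoʳ-≤ 3 before) lo₁) (<⇒≱ hi₂)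

  -- The job would run at `t` if started at its release, so every feasible schedule completes it
  -- only after `t`.
  TightPending : ℕ → Fin n → Set
  TightPending t i = isLoose (J i) ≡ false × Runs (R i) (P i) t

  not-loose : ∀ i → isLoose (J i) ≡ false → D < R i + 3 * P i
  not-loose i tight with 3 * p (J i) ≤? d (J i) ∸ r (J i)
  ... | no l = ≰⇒> λ R+3P≤D → l (m+n≤o⇒m≤o∸n (3 * P i)
    (≤-trans (≤-reflexive (+-comm (3 * P i) (R i))) (≤-trans R+3P≤D (≤-reflexive (sym (deadline i))))))
  ... | yes l = contradiction (trans (sym (dec-true (3 * p (J i) ≤? d (J i) ∸ r (J i)) l)) tight) λ ()

  is-loose : ∀ i → isLoose (J i) ≡ true → R i + 3 * P i ≤ D
  is-loose i loose with 3 * p (J i) ≤? d (J i) ∸ r (J i)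
  ... | no l = contradiction (trans (sym (dec-false (3 * p (J i) ≤? d (J i) ∸ r (J i)) l)) loose) λ ()
  ... | yes l = begin
    R i + 3 * P i         ≤⟨ +-monoʳ-≤ (R i) l ⟩
    R i + (d (J i) ∸ R i) ≡⟨ cong (λ x → R i + (x ∸ R i)) (deadline i) ⟩
    R i + (D ∸ R i)       ≡⟨ m+[n∸m]≡n (≤-trans (R≤O i) (m+n≤o⇒m≤o (O i) (O+P≤D i))) ⟩
    D                     ∎
    where open ≤-Reasoning

  tight-positive : ∀ i → isLoose (J i) ≡ false → 0 < P i
  tight-positive i tight = *-cancelˡ-< 3 0 (P i) (+-cancelˡ-< (R i) 0 (3 * P i) (begin-strict
    R i + 0       ≡⟨ +-identityʳ (R i) ⟩
    R i           ≤⟨ R≤O i ⟩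
    O i           ≤⟨ m+n≤o⇒m≤o (O i) (O+P≤D i) ⟩
    D             <⟨ not-loose i tight ⟩
    R i + 3 * P i ∎))
    where open ≤-Reasoning

  point : ∀ t i → TightPending t i →
    ∃ λ (c : Fin 3) → 3 * O i ≤ 3 * t + toℕ c * (D ∸ t) × 3 * t + toℕ c * (D ∸ t) < 3 * (O i + P i)
  point t i (tight , R≤t , t<R+P) =
    third-point {t} {O i} {P i} (≤-trans (O+P≤D i) (≤-reflexive (sym t+L≡D))) t<O+P
      (+-cancelˡ-< t _ _ (begin-strict
        t + (D ∸ t)   ≡⟨ t+L≡D ⟩
        D             <⟨ not-loose i tight ⟩
        R i + 3 * P i ≤⟨ +-monoˡ-≤ (3 * P i) R≤t ⟩
        t + 3 * P i   ∎))
    where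
    open ≤-Reasoning
    t<O+P : t < O i + P i
    t<O+P = ≤-trans t<R+P (+-monoˡ-≤ (P i) (R≤O i))
    t+L≡D : t + (D ∸ t) ≡ D
    t+L≡D = m+[n∸m]≡n (≤-trans (<⇒≤ t<O+P) (O+P≤D i))

  -- Pigeonhole on pairs of a machine of `σ` and a third point: two jobs with the same pair would
  -- overlap in `σ`.
  tight-pending-bound : ∀ t (g : Fin (suc (m * 3)) → Fin n) → (∀ x → TightPending t (g x)) →
    (∀ x y → g x ≡ g y → x ≡ y) → ⊥
  tight-pending-bound t g pending inj with pigeonhole (n<1+n (m * 3)) slot
    where
    slot : Fin (suc (m * 3)) → Fin (m * 3)
    slot x = combine (fromℕ< (N<m (g x))) (proj₁ (point t (g x) (pending x)))
  ... | x , y , x<y , slots≡ = <⇒≢ᶠ x<y (inj x y (exclusive (g x) (g y)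
      (fromℕ<-injective _ _ (N<m (g x)) (N<m (g y)) (proj₁ both))
      (proj₁ (proj₂ px)) (proj₂ (proj₂ px))
      (subst (λ c → 3 * O (g y) ≤ 3 * t + toℕ c * (D ∸ t)) (sym (proj₂ both)) (proj₁ (proj₂ py)))
      (subst (λ c → 3 * t + toℕ c * (D ∸ t) < 3 * (O (g y) + P (g y))) (sym (proj₂ both)) (proj₂ (proj₂ py)))))
    where
    px = point t (g x) (pending x)
    py = point t (g y) (pending y)
    both = combine-injective (fromℕ< (N<m (g x))) (proj₁ px) (fromℕ< (N<m (g y))) (proj₁ py) slots≡

  -- Induction on the start time. If `i` waits at its release, all `3m` tight machines run jobs with
  -- earlier starts, which by induction started at their releases. Together with `i` these are
  -- `3m + 1` pending tight jobs.
  tight-immediate : ∀ i → isLoose (J i) ≡ false → S i ≡ R i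
  tight-immediate i tight = <-rec Claim step (S i) i refl tight
    where
    Claim : ℕ → Set
    Claim s = ∀ i → S i ≡ s → isLoose (J i) ≡ false → S i ≡ R i
    step : ∀ s → (∀ {u} → u < s → Claim u) → Claim s
    step _ IH i refl tight with m≤n⇒m<n∨m≡n (R≤S i)
    ... | inj₂ R≡S = sym R≡S
    ... | inj₁ R<S = ⊥-elim (tight-pending-bound (R i) g pending inj)
      where
      busy : ∀ (μ : Fin (m * 3)) → RunsIn false (R i) (toℕ μ)
      busy μ = subst (λ b → toℕ μ < width m b → RunsIn b (R i) (toℕ μ)) tight
        (busy-while-waiting i (R i) ≤-refl R<S (toℕ μ)) (toℕ<n μ)
      g : Fin (suc (m * 3)) → Fin n
      g zero    = i
      g (suc μ) = proj₁ (busy μ)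
      pending : ∀ x → TightPending (R i) (g x)
      pending zero    = tight , ≤-refl , m<m+n (R i) (tight-positive i tight)
      pending (suc μ) with j , tightⱼ , (S≤t , t<S+P) , _ ← busy μ =
        tightⱼ , ≤-trans (R≤S j) S≤t ,
        subst (λ s → R i < s + P j) (IH (≤-trans (s≤s S≤t) R<S) j refl tightⱼ) t<S+P
      not-i : ∀ μ → i ≢ proj₁ (busy μ)
      not-i μ i≡ = <⇒≱ R<S (subst (λ j → S j ≤ R i) (sym i≡) (proj₁ (proj₁ (proj₂ (proj₂ (busy μ))))))
      inj : ∀ x y → g x ≡ g y → x ≡ y
      inj zero    zero    _  = refl
      inj zero    (suc ν) eq = contradiction eq (not-i ν)
      inj (suc μ) zero    eq = contradiction (sym eq) (not-i μ)
      inj (suc μ) (suc ν) eq = cong suc (toℕ-injective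
        (trans (sym (proj₂ (proj₂ (proj₂ (busy μ))))) (trans (cong M eq) (proj₂ (proj₂ (proj₂ (busy ν)))))))

  -- The loose jobs fitted to the backlog argument.

  -- Tight jobs stay in the index set with length 0: they never run and add no volume.
  Q : Fin n → ℕ
  Q i = if isLoose (J i) then P i else 0

  Q≤P : ∀ i → Q i ≤ P i
  Q≤P i with isLoose (J i)
  ... | true  = ≤-refl
  ... | false = z≤n

  o-width : ∀ t → Volume.running Q O t ≤ m
  o-width t = ≤-trans (double-count {R = λ i μ → Runs (O i) (Q i) t × N i ≡ toℕ μ}
    (λ i → runs? (O i) (Q i) t) (λ _ → yes tt) (λ i μ → runs? (O i) (Q i) t ×-dec (N i ≟ toℕ μ))
    (λ i run → fromℕ< (N<m i) , run , sym (toℕ-fromℕ< (N<m i)))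
    (λ i j μ (runᵢ , Nᵢ≡μ) (runⱼ , Nⱼ≡μ) → exclusive i j (trans Nᵢ≡μ (sym Nⱼ≡μ))
      (*-monoʳ-≤ 3 (proj₁ runᵢ)) (*-monoʳ-< 3 (≤-trans (proj₂ runᵢ) (+-monoʳ-≤ (O i) (Q≤P i))))
      (*-monoʳ-≤ 3 (proj₁ runⱼ)) (*-monoʳ-< 3 (≤-trans (proj₂ runⱼ) (+-monoʳ-≤ (O j) (Q≤P j)))))
    (λ _ _ _ → tt)) (≤-reflexive (sum-ones m))

  -- Only loose jobs wait, by `tight-immediate`, so each machine of the loose pool runs a loose job,
  -- whose `Q` is its full length.
  s-busy : ∀ i t → R i ≤ t → t < S i → width m true ≤ Volume.running Q S t
  s-busy i t R≤t t<S = ≤-trans (≤-reflexive (sym (sum-ones (width m true))))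
    (double-count {R = λ μ j → Runs (S j) (Q j) t × M j ≡ offset m true + toℕ μ}
      (λ _ → yes tt) (λ j → runs? (S j) (Q j) t)
      (λ μ j → runs? (S j) (Q j) t ×-dec (M j ≟ offset m true + toℕ μ))
      (λ μ _ → running μ)
      (λ μ ν j (_ , M≡μ) (_ , M≡ν) → toℕ-injective (+-cancelˡ-≡ (offset m true) _ _ (trans (sym M≡μ) M≡ν)))
      (λ _ _ → proj₁))
    where
    loose : isLoose (J i) ≡ true
    loose with bool-cases (isLoose (J i))
    ... | inj₁ loose = loose
    ... | inj₂ tight = contradiction (≤-trans t<S (≤-reflexive (tight-immediate i tight))) (≤⇒≯ R≤t)
    running : ∀ (μ : Fin (width m true)) → ∃ λ j → Runs (S j) (Q j) t × M j ≡ offset m true + toℕ μ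
    running μ with subst (λ b → toℕ μ < width m b → RunsIn b t (toℕ μ)) loose
                     (busy-while-waiting i t R≤t t<S (toℕ μ)) (toℕ<n μ)
    ... | j , looseⱼ , run , M≡ = j ,
      subst (λ q → Runs (S j) q t) (sym (cong (λ b → if b then P j else 0) looseⱼ)) run , M≡

  R+3Q≤D : ∀ i → R i + 3 * Q i ≤ D
  R+3Q≤D i with isLoose (J i) in eq
  ... | true  = is-loose i eq
  ... | false = ≤-trans (≤-reflexive (+-identityʳ (R i)))
                  (≤-trans (R≤O i) (m+n≤o⇒m≤o (O i) (O+P≤D i)))

  -- The constants `k` and `B`, and feasibility on `3m + k` machines.

  module _ (0<m : 0 < m) where

    k : ℕ
    k = width m true

    4k≤9m : 4 * k ≤ 9 * m
    4k≤9m = ≤-trans (≤-reflexive (*-comm 4 k)) (m/n*n≤m (9 * m) 4)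

    9m≤4k+3 : 9 * m ≤ 4 * k + 3
    9m≤4k+3 = begin
      9 * m                         ≡⟨ m≡m%n+[m/n]*n (9 * m) 4 ⟩
      9 * m % 4 + k * 4             ≤⟨ +-monoˡ-≤ (k * 4) (≤-pred (m%n<n (9 * m) 4)) ⟩
      3 + k * 4                     ≡⟨ trans (+-comm 3 (k * 4)) (cong (_+ 3) (*-comm k 4)) ⟩
      4 * k + 3                     ∎
      where open ≤-Reasoning

    -- Rounding down costs at most 3 in `4 * k`; the surplus `9m - 6m = 3m` covers it because `m` is
    -- positive.
    3m≤2k : 3 * m ≤ 2 * k
    3m≤2k = *-cancelˡ-≤ 2 (+-cancelʳ-≤ 3 (2 * (3 * m)) (2 * (2 * k)) (begin
      2 * (3 * m) + 3     ≤⟨ +-monoʳ-≤ (2 * (3 * m)) (*-monoʳ-≤ 3 0<m) ⟩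
      2 * (3 * m) + 3 * m ≡⟨ eq₁ m ⟩
      9 * m               ≤⟨ 9m≤4k+3 ⟩
      4 * k + 3           ≡⟨ eq₂ k ⟩
      2 * (2 * k) + 3     ∎))
      where
      open ≤-Reasoning
      eq₁ : ∀ m → 2 * (3 * m) + 3 * m ≡ 9 * m
      eq₁ = solve-∀
      eq₂ : ∀ k → 4 * k + 3 ≡ 2 * (2 * k) + 3
      eq₂ = solve-∀

    B : ℕ
    B = 2 * k ∸ 3 * m

    3m+B≡2k : 3 * m + B ≡ 2 * k
    3m+B≡2k = m+[n∸m]≡n 3m≤2k

    -- With `2B = 4k - 6m` this reads `9m ≤ 4k + 3`, and `⌊9m/4⌋` is the least `k` satisfying it.
    3m≤2B+3 : 3 * m ≤ 2 * B + 3
    3m≤2B+3 = +-cancelʳ-≤ (2 * (3 * m)) (3 * m) (2 * B + 3) (begin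
      3 * m + 2 * (3 * m)     ≡⟨ eq₁ m ⟩
      9 * m                   ≤⟨ 9m≤4k+3 ⟩
      4 * k + 3               ≡⟨ eq₂ k ⟩
      2 * (2 * k) + 3         ≡⟨ cong (λ x → 2 * x + 3) 3m+B≡2k ⟨
      2 * (3 * m + B) + 3     ≡⟨ eq₃ m B ⟩
      2 * B + 3 + 2 * (3 * m) ∎)
      where
      open ≤-Reasoning
      eq₁ : ∀ m → 3 * m + 2 * (3 * m) ≡ 9 * m
      eq₁ = solve-∀
      eq₂ : ∀ k → 4 * k + 3 ≡ 2 * (2 * k) + 3
      eq₂ = solve-∀
      eq₃ : ∀ m B → 2 * (3 * m + B) + 3 ≡ 2 * B + 3 + 2 * (3 * m)
      eq₃ = solve-∀

    k<3m : k < 3 * m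
    k<3m = *-cancelˡ-< 4 k (3 * m) (begin-strict
      4 * k         ≤⟨ 4k≤9m ⟩
      9 * m         <⟨ *-monoˡ-< m {{>-nonZero 0<m}} {9} {12} (m<m+n 9 {3} (s≤s z≤n)) ⟩
      12 * m        ≡⟨ eq m ⟩
      4 * (3 * m)   ∎)
      where
      open ≤-Reasoning
      eq : ∀ m → 12 * m ≡ 4 * (3 * m)
      eq = solve-∀

    B<k : B < k
    B<k = +-cancelˡ-< k B k (begin-strict
      k + B         <⟨ +-monoˡ-< B k<3m ⟩
      3 * m + B     ≡⟨ 3m+B≡2k ⟩
      2 * k         ≡⟨ cong (k +_) (+-identityʳ k) ⟩
      k + k         ∎)
      where open ≤-Reasoning

    0<width : ∀ b → 0 < width m b
    0<width true  = ≤-trans (s≤s z≤n) B<k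
    0<width false = *-mono-≤ 0<m (s≤s {n = 2} z≤n)

    loose-deadline : ∀ i → isLoose (J i) ≡ true → S i + P i ≤ D
    loose-deadline i loose = subst (λ q → S i + q ≤ D) (cong (λ b → if b then P i else 0) loose)
      (Loose.meets-deadline m k B D R Q S O 3m+B≡2k 3m≤2B+3 B<k R+3Q≤D R≤O
        (λ i → ≤-trans (+-monoʳ-≤ (O i) (Q≤P i)) (O+P≤D i)) o-width R≤S s-busy i)

    target<width : ∀ b h → target (width m b) h < width m b
    target<width b h = earliest< (free (width m b) h) (0<width b)

    machines : ∀ i → M i < m * 3 + k
    machines i with isLoose (J i)
    ... | true  = +-monoʳ-< (m * 3) (target<width true (inPool true (history I I i)))
    ... | false = ≤-trans (target<width false (inPool false (history I I i))) (m≤m+n (m * 3) k)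

    tight-machine : ∀ i → isLoose (J i) ≡ false → M i < m * 3
    tight-machine i tight with isLoose (J i)
    ... | false = target<width false (inPool false (history I I i))

    loose-machine : ∀ i → isLoose (J i) ≡ true → m * 3 ≤ M i
    loose-machine i loose with isLoose (J i)
    ... | true = m≤m+n (m * 3) _

    deadlines : ∀ i → S i + P i ≤ D
    deadlines i with bool-cases (isLoose (J i))
    ... | inj₁ loose = loose-deadline i loose
    ... | inj₂ tight = ≤-trans (+-monoˡ-≤ (P i) (≤-trans (≤-reflexive (tight-immediate i tight)) (R≤O i))) (O+P≤D i)

    pool-of-machine : ∀ i j → M i ≡ M j → isLoose (J i) ≡ isLoose (J j)
    pool-of-machine i j M≡ with bool-cases (isLoose (J i)) | bool-cases (isLoose (J j))
    ... | inj₁ x | inj₁ y = trans x (sym y)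
    ... | inj₂ x | inj₂ y = trans x (sym y)
    ... | inj₁ x | inj₂ y = contradiction (≤-trans (loose-machine i x) (≤-reflexive M≡)) (<⇒≱ (tight-machine j y))
    ... | inj₂ x | inj₁ y = contradiction (≤-trans (loose-machine j y) (≤-reflexive (sym M≡))) (<⇒≱ (tight-machine i x))

  algorithm-feasible : FeasibleSchedule I (m * 3 + width m true) (algorithm m I)
  algorithm-feasible =
    (λ i → machines (nonempty i) i) , R≤S ,
    (λ i → ≤-trans (deadlines (nonempty i) i) (≤-reflexive (sym (deadline i)))) ,
    (λ i j i≢j M≡ → disjoint i j i≢j (pool-of-machine (nonempty i) i j M≡) M≡)
    where
    -- An empty instance has `m = 0` as optimum, so positivity is derived from each job, which
    -- occupies one of the `m` machines of `σ`.
    nonempty : Fin n → 0 < m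
    nonempty i = ≤-trans (s≤s z≤n) (N<m i)

theorem16 : Σ Algorithm (λ A → NonAnticipatory A × CompetitiveUniform 21 4 A)
theorem16 = algorithm , nonAnticipatory , competitive
  where
  competitive : CompetitiveUniform 21 4 algorithm
  -- The constant is `3 + 9/4 = 21/4`; rounding down keeps the machine count below it.
  competitive m I (D , uniform) ((σ , feasible) , _) = m * 3 + 9 * m / 4 , bound ,
    Competitive.algorithm-feasible m I D (λ i → All.lookup uniform (∈-lookup i)) σ feasible
    where
    open ≤-Reasoning
    eq₁ : ∀ m k → 4 * (m * 3 + k) ≡ 12 * m + k * 4
    eq₁ = solve-∀
    eq₂ : ∀ m → 12 * m + 9 * m ≡ 21 * m
    eq₂ = solve-∀
    bound : 4 * (m * 3 + 9 * m / 4) ≤ 21 * m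
    bound = begin
      4 * (m * 3 + 9 * m / 4)    ≡⟨ eq₁ m (9 * m / 4) ⟩
      12 * m + 9 * m / 4 * 4     ≤⟨ +-monoʳ-≤ (12 * m) (m/n*n≤m (9 * m) 4) ⟩
      12 * m + 9 * m             ≡⟨ eq₂ m ⟩
      21 * m                     ∎
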